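{- For every constant $c\ge 0$ there is a constant $C$ such that for every access sequence $X=(x_1,\dots,x_m)$ with no repeated key values, if $G_X$ contains at most $c$ z-rectangles, then $\mathsf{IRB}_{\uparrow}(X)\le C\,m$.
   Context: $G_X=\{(x_i,i): i\in[m]\}$; for a point $p$, $p.x,p.y$ are its coordinates. For a point set $P$, a z-rectangle of $P$ is a tuple $(p,q,r,s)\in P^4$ with $q.x<p.x<r.x<s.x$, $r.y<q.y<s.y<p.y$, and $P\cap([q.x,s.x]\times[r.y,p.y])=\{p,q,r,s\}$. For points $p,q$, $\mathrm{rect}(p,q)$ is the smallest closed axis-aligned rectangle containing both. $\mathsf{IRB}_{\uparrow}$: sweep a horizontal line upward over the points of $P=G_X$ in increasing $y$-coordinate, maintaining a set $Q$ which initially is $P$. When the sweep reaches the point $p\in P$, for every point $q$ of $Q$ (as it stands when $p$ is reached, i.e. $P$ together with all points added at earlier sweep positions) with $q.x<p.x$, $q.y<p.y$ and $Q\cap\mathrm{rect}(p,q)=\{p,q\}$, add the upper-left corner $(q.x,p.y)$ of $\mathrm{rect}(p,q)$ to $Q$. Let $\mathrm{add}_{\uparrow}(P)$ be the set of all added points (excluding those originally in $P$) and $\mathsf{IRB}_{\uparrow}(X)=|\mathrm{add}_{\uparrow}(G_X)|$. -}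

module Defs where

open import Data.Bool using (Bool; true; false; _∧_; _∨_; not)
open import Data.Nat using (ℕ; suc; _≤ᵇ_; _<ᵇ_; _⊓_; _⊔_)
open import Data.Nat.Base using (_≡ᵇ_)
open import Data.Nat.Properties using (_≟_)
open import Data.Product using (_×_; _,_; proj₁; proj₂)
open import Data.Product.Properties using (≡-dec)
open import Data.List using (List; []; _∷_; _++_; map; length; zipWith; applyUpTo; filterᵇ; deduplicate)
open import Data.Bool.ListAction using (all; any)

Point : Set
Point = ℕ × ℕ

_·x : Point → ℕ
p ·x = proj₁ p

_·y : Point → ℕ
p ·y = proj₂ p

_≡ₚ_ : Point → Point → Bool
a ≡ₚ b = (a ·x ≡ᵇ b ·x) ∧ (a ·y ≡ᵇ b ·y)

_∈ₚ_ : Point → List Point → Bool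
a ∈ₚ Q = any (a ≡ₚ_) Q

G : List ℕ → List Point
G X = zipWith _,_ X (applyUpTo suc (length X))

inBox : ℕ → ℕ → ℕ → ℕ → Point → Bool
inBox x₁ x₂ y₁ y₂ a = (x₁ ≤ᵇ a ·x) ∧ (a ·x ≤ᵇ x₂) ∧ (y₁ ≤ᵇ a ·y) ∧ (a ·y ≤ᵇ y₂)

inRect : Point → Point → Point → Bool
inRect p q = inBox (p ·x ⊓ q ·x) (p ·x ⊔ q ·x) (p ·y ⊓ q ·y) (p ·y ⊔ q ·y)

isZRect : List Point → Point → Point → Point → Point → Bool
isZRect P p q r s =
  (q ·x <ᵇ p ·x) ∧ (p ·x <ᵇ r ·x) ∧ (r ·x <ᵇ s ·x) ∧
  (r ·y <ᵇ q ·y) ∧ (q ·y <ᵇ s ·y) ∧ (s ·y <ᵇ p ·y) ∧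
  all (λ a → not (inBox (q ·x) (s ·x) (r ·y) (p ·y) a)
             ∨ (a ≡ₚ p) ∨ (a ≡ₚ q) ∨ (a ≡ₚ r) ∨ (a ≡ₚ s)) P

tuples4 : List Point → List (Point × Point × Point × Point)
tuples4 P =
  Data.List.concatMap (λ p → Data.List.concatMap (λ q → Data.List.concatMap (λ r →
    map (λ s → (p , q , r , s)) P) P) P) P

zRectCount : List Point → ℕ
zRectCount P =
  length (filterᵇ (λ { (p , q , r , s) → isZRect P p q r s }) (tuples4 P))

-- Q ∩ rect(p,q) = {p,q}  (p, q are themselves in Q)
emptyRect : List Point → Point → Point → Bool
emptyRect Q p q = all (λ a → not (inRect p q a) ∨ (a ≡ₚ p) ∨ (a ≡ₚ q)) Q

newPoints : List Point → Point → List Point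
newPoints Q p =
  map (λ q → (q ·x , p ·y))
      (filterᵇ (λ q → (q ·x <ᵇ p ·x) ∧ (q ·y <ᵇ p ·y) ∧ emptyRect Q p q) Q)

-- sweep over the remaining points of P (given in increasing y), updating Q
sweep : List Point → List Point → List Point
sweep Q []       = Q
sweep Q (p ∷ ps) = sweep (Q ++ newPoints Q p) ps

-- add↑(P) for P listed in increasing y-order: all added points not in P,
-- as a duplicate-free list
add↑ : List Point → List Point
add↑ P = deduplicate (≡-dec _≟_ _≟_) (filterᵇ (λ a → not (a ∈ₚ P)) (sweep P P))

IRB↑ : List ℕ → ℕ
IRB↑ X = length (add↑ (G X))

{-# OPTIONS --safe #-}
-- Let S be the final point set of the sweep, and say that p ∈ P sees q ∈ S if q lies to the
-- lower left of p and their rectangle contains no other point of S below the row of p; the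
-- added points are the corners (q.x, p.y) of such pairs.  Each q is seen at most once,
-- because the corner blocks every later view, so the original q account for at most m
-- corners.  If p sees two points, the left one of them not original, then P has a
-- z-rectangle whose top is p.  Hence, outside of at most c rows, a non-original q accounts
-- for at most one corner per row, and the total is at most m + m + c m.
module Submission where

open import Defs
open import Data.Bool using (Bool; T; true; false; _∧_; _∨_; not)
open import Data.Bool.Properties using (T-∧; T-∨)
open import Data.List using (List; []; _∷_; _++_; length; map; zipWith; filterᵇ; cartesianProduct)
open import Data.List.Membership.Propositional using (_∈_; _∉_; find; lose)
open import Data.List.Membership.Propositional.Properties
open import Data.List.Properties using (length-map; length-++; length-zipWith; length-applyUpTo)
open import Data.List.Relation.Unary.All using (_∷_; lookup; tabulate)
open import Data.List.Relation.Unary.All.Properties using (all⁺; all⁻)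
open import Data.List.Relation.Unary.AllPairs as AllPairs using (AllPairs; []; _∷_)
open import Data.List.Relation.Unary.AllPairs.Properties using (applyUpTo⁺₁)
open import Data.List.Relation.Unary.Any using (here; there; any?)
open import Data.List.Relation.Unary.Unique.Propositional using (Unique)
open import Data.Nat using (ℕ; suc; _+_; _*_; _⊓_; _≤_; _<_; _≥_; _<ᵇ_; z≤n; s≤s; _<?_; _≤?_)
open import Data.Nat.Induction using (<-rec)
open import Data.Nat.Properties
open import Data.Product using (∃-syntax; _×_; _,_; proj₁; proj₂)
open import Data.Product.Properties using (≡-dec)
open import Data.Sum using (_⊎_; inj₁; inj₂; [_,_]′)
open import Function using (_∘_; id; case_of_)
open import Function.Bundles using (Equivalence)
open import Level using (0ℓ)
open import Relation.Binary using (Rel; Transitive; Total; tri<; tri≈; tri>)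
open import Relation.Binary.PropositionalEquality using (_≡_; _≢_; refl; sym; trans; cong; cong₂; subst)
open import Relation.Nullary using (¬_; yes; no; contradiction; _×-dec_; T?)
open import Relation.Unary using (Pred; Decidable)
open import Data.List.Membership.DecPropositional {A = Point} (≡-dec _≟_ _≟_) using (_∈?_)
open import Data.List.Relation.Unary.Unique.DecPropositional.Properties (≡-dec _≟_ _≟_) using (deduplicate-!)

open Equivalence using (to; from)

-- Lists

length-cartesianProduct : ∀ {A B : Set} (xs : List A) (ys : List B) →
  length (cartesianProduct xs ys) ≡ length xs * length ys
length-cartesianProduct []       ys = refl
length-cartesianProduct (x ∷ xs) ys =
  trans (length-++ (map (x ,_) ys))
        (cong₂ _+_ (length-map (x ,_) ys) (length-cartesianProduct xs ys))

module _ {A B : Set} {R : A → B → Set} (R-injective : ∀ {a a′ b} → R a b → R a′ b → a ≡ a′) where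

  -- Pigeonhole by removal: the partner `b` of the head is cut out of `ys`, and no other element of
  -- `xs` can have chosen that occurrence, since `R` relates at most one `a` to each `b`. A relation
  -- in place of a function lets partners be chosen case by case.
  length-≤-by-injection : ∀ {xs} (ys : List B) → Unique xs →
    (∀ {a} → a ∈ xs → ∃[ b ] (b ∈ ys × R a b)) → length xs ≤ length ys
  length-≤-by-injection {[]}     ys _          f = z≤n
  length-≤-by-injection {a ∷ xs} ys (a≢ ∷ xs!) f with f (here refl)
  ... | b , b∈ys , Rab with ∈-∃++ b∈ys
  ... | us , vs , refl = begin
    suc (length xs)              ≤⟨ s≤s (length-≤-by-injection (us ++ vs) xs! f′) ⟩
    suc (length (us ++ vs))      ≡⟨ cong suc (length-++ us) ⟩
    suc (length us + length vs)  ≡⟨ +-suc (length us) (length vs) ⟨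
    length us + suc (length vs)  ≡⟨ length-++ us ⟨
    length (us ++ b ∷ vs)        ∎
    where
    open ≤-Reasoning
    f′ : ∀ {a′} → a′ ∈ xs → ∃[ b′ ] (b′ ∈ us ++ vs × R a′ b′)
    f′ a′∈ with f (there a′∈)
    ... | b′ , b′∈ , Ra′b′ with ∈-++⁻ us b′∈
    ... | inj₁ b′∈us         = b′ , ∈-++⁺ˡ b′∈us , Ra′b′
    ... | inj₂ (there b′∈vs) = b′ , ∈-++⁺ʳ us b′∈vs , Ra′b′
    ... | inj₂ (here refl)   = contradiction (R-injective Rab Ra′b′) (lookup a≢ a′∈)

module _ {A : Set} {_≲_ : Rel A 0ℓ} (≲-trans : Transitive _≲_) (≲-total : Total _≲_)
         {D : Pred A 0ℓ} (D? : Decidable D) where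

  -- The order is an arbitrary total preorder, so that one search yields leftmost, rightmost and
  -- highest points. Reflexivity comes from totality.
  least : ∀ {a} xs → a ∈ xs → D a → ∃[ m ] (m ∈ xs × D m × (∀ {b} → b ∈ xs → D b → m ≲ b))
  least (x ∷ xs) a∈ Da with any? D? xs
  ... | no none = case a∈ of λ where
    (here refl) → x , here refl , Da , λ where
      (here refl) _  → [ id , id ]′ (≲-total x x)
      (there b∈)  Db → contradiction (lose b∈ Db) none
    (there a∈)  → contradiction (lose a∈ Da) none
  ... | yes some with find some
  ... | a′ , a′∈ , Da′ with least xs a′∈ Da′ | D? x
  ... | m , m∈ , Dm , m≲ | no ¬Dx = m , there m∈ , Dm , λ where
    (here refl) Db → contradiction Db ¬Dx
    (there b∈)  Db → m≲ b∈ Db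
  ... | m , m∈ , Dm , m≲ | yes Dx with ≲-total m x
  ... | inj₁ m≲x = m , there m∈ , Dm , λ where
    (here refl) _  → m≲x
    (there b∈)  Db → m≲ b∈ Db
  ... | inj₂ x≲m = x , here refl , Dx , λ where
    (here refl) _  → [ id , id ]′ (≲-total x x)
    (there b∈)  Db → ≲-trans x≲m (m≲ b∈ Db)

AllPairs-≢⇒injective : ∀ {A B : Set} {f : A → B} {xs a b} → AllPairs (λ u v → f u ≢ f v) xs →
  a ∈ xs → b ∈ xs → f a ≡ f b → a ≡ b
AllPairs-≢⇒injective _          (here refl) (here refl) _  = refl
AllPairs-≢⇒injective (≢s ∷ _)   (here refl) (there b∈)  eq = contradiction eq (lookup ≢s b∈)
AllPairs-≢⇒injective (≢s ∷ _)   (there a∈)  (here refl) eq = contradiction (sym eq) (lookup ≢s a∈)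
AllPairs-≢⇒injective (_ ∷ rest) (there a∈)  (there b∈)  eq = AllPairs-≢⇒injective rest a∈ b∈ eq

module _ {A B : Set} where

  ∈-zip⁻ : ∀ {a : A × B} xs ys → a ∈ zipWith _,_ xs ys → proj₁ a ∈ xs × proj₂ a ∈ ys
  ∈-zip⁻ (x ∷ xs) (y ∷ ys) (here refl) = here refl , here refl
  ∈-zip⁻ (x ∷ xs) (y ∷ ys) (there a∈) with ∈-zip⁻ xs ys a∈
  ... | x∈ , y∈ = there x∈ , there y∈

  AllPairs-zip⁺ : ∀ {R : Rel A 0ℓ} {R′ : Rel B 0ℓ} {xs ys} → AllPairs R xs → AllPairs R′ ys →
    AllPairs (λ a b → R (proj₁ a) (proj₁ b) × R′ (proj₂ a) (proj₂ b)) (zipWith _,_ xs ys)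
  AllPairs-zip⁺ []       _        = []
  AllPairs-zip⁺ (_ ∷ _)  []       = []
  AllPairs-zip⁺ (r ∷ rs) (s ∷ ss) =
    tabulate (λ b∈ → let x∈ , y∈ = ∈-zip⁻ _ _ b∈ in lookup r x∈ , lookup s y∈) ∷ AllPairs-zip⁺ rs ss

-- Reflection of the Boolean tests

T-⇒⁺ : ∀ {b c} → (T b → T c) → T (not b ∨ c)
T-⇒⁺ {false} _ = _
T-⇒⁺ {true}  f = f _

T-⇒⁻ : ∀ {b c} → T (not b ∨ c) → T b → T c
T-⇒⁻ {true} t _ = t

≡ₚ⁺ : ∀ {a b} → a ≡ b → T (a ≡ₚ b)
≡ₚ⁺ {x , y} refl = from T-∧ (≡⇒≡ᵇ x x refl , ≡⇒≡ᵇ y y refl)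

≡ₚ⁻ : ∀ a b → T (a ≡ₚ b) → a ≡ b
≡ₚ⁻ a b t = let tx , ty = to T-∧ t in cong₂ _,_ (≡ᵇ⇒≡ (a ·x) (b ·x) tx) (≡ᵇ⇒≡ (a ·y) (b ·y) ty)

InBox : ℕ → ℕ → ℕ → ℕ → Point → Set
InBox x₁ x₂ y₁ y₂ a = x₁ ≤ a ·x × a ·x ≤ x₂ × y₁ ≤ a ·y × a ·y ≤ y₂

inBox⁺ : ∀ {x₁ x₂ y₁ y₂} a → InBox x₁ x₂ y₁ y₂ a → T (inBox x₁ x₂ y₁ y₂ a)
inBox⁺ a (p , q , r , s) =
  from T-∧ (≤⇒≤ᵇ p , from T-∧ (≤⇒≤ᵇ q , from T-∧ (≤⇒≤ᵇ r , ≤⇒≤ᵇ s)))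

inBox⁻ : ∀ {x₁ x₂ y₁ y₂} a → T (inBox x₁ x₂ y₁ y₂ a) → InBox x₁ x₂ y₁ y₂ a
inBox⁻ {x₁} {x₂} {y₁} {y₂} a t =
  let p , t₁ = to T-∧ t ; q , t₂ = to T-∧ t₁ ; r , s = to T-∧ t₂
  in ≤ᵇ⇒≤ x₁ _ p , ≤ᵇ⇒≤ (a ·x) _ q , ≤ᵇ⇒≤ y₁ _ r , ≤ᵇ⇒≤ (a ·y) _ s

inRect-lowerLeft : ∀ {p q} → q ·x ≤ p ·x → q ·y ≤ p ·y →
  inRect p q ≡ inBox (q ·x) (p ·x) (q ·y) (p ·y)
inRect-lowerLeft x≤ y≤
  rewrite m≥n⇒m⊓n≡n x≤ | m≥n⇒m⊔n≡m x≤ | m≥n⇒m⊓n≡n y≤ | m≥n⇒m⊔n≡m y≤ = refl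

-- Visibility

-- The row of p is excluded, so that "sees" does not depend on whether S is taken before or
-- after the sweep treats p.
record Sees (S : List Point) (p q : Point) : Set where
  constructor sees
  field
    source : q ∈ S
    left   : q ·x < p ·x
    below  : q ·y < p ·y
    alone  : ∀ {a} → a ∈ S → q ·x ≤ a ·x → a ·x ≤ p ·x → q ·y ≤ a ·y → a ·y < p ·y → a ≡ q

ZRect : List Point → Point → Point → Point → Point → Set
ZRect P p q r s =
  (q ·x < p ·x × p ·x < r ·x × r ·x < s ·x × r ·y < q ·y × q ·y < s ·y × s ·y < p ·y) ×
  (∀ {a} → a ∈ P → InBox (q ·x) (s ·x) (r ·y) (p ·y) a → a ≡ p ⊎ a ≡ q ⊎ a ≡ r ⊎ a ≡ s)

HasTop : List Point → Point → Set
HasTop P p = ∃[ q ] ∃[ r ] ∃[ s ] (q ∈ P × r ∈ P × s ∈ P × ZRect P p q r s)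

-- Besides distinct coordinates in `P`, the sweep enters only through its final set `S`: every
-- non-original point is the corner of a view, and every view has its corner in `S`. Sweep time thus
-- disappears from the argument.
module Closure
  (P S : List Point)
  (x-injective : ∀ {a b} → a ∈ P → b ∈ P → a ·x ≡ b ·x → a ≡ b)
  (y-injective : ∀ {a b} → a ∈ P → b ∈ P → a ·y ≡ b ·y → a ≡ b)
  (P⊆S : ∀ {a} → a ∈ P → a ∈ S)
  (S-origin : ∀ {a} → a ∈ S → a ∈ P ⊎ ∃[ p ] ∃[ q ] (p ∈ P × Sees S p q × a ≡ (q ·x , p ·y)))
  (S-closed : ∀ {p q} → p ∈ P → Sees S p q → (q ·x , p ·y) ∈ S)
  where

  open Sees

  -- A view of a non-original point q comes from the left of the point that produced q.
  producer-right : ∀ {p p′ q′} → p′ ∈ P → Sees S p′ q′ → Sees S p (q′ ·x , p′ ·y) → p ·x < p′ ·x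
  producer-right p′∈P v′ v = ≰⇒> λ p′≤p →
    <⇒≢ (left v′) (sym (cong _·x (alone v (P⊆S p′∈P) (<⇒≤ (left v′)) p′≤p ≤-refl (below v))))

  -- The region in `clear` extends the rectangle of the view downwards, stopping just above the row
  -- of `base`. It leaves out the column of `q` itself, where other added points may lie.
  record ColumnBase (p q : Point) : Set where
    field
      base   : Point
      base∈P : base ∈ P
      sameˣ  : base ·x ≡ q ·x
      lower  : base ·y ≤ q ·y
      clear  : ∀ {a} → a ∈ S → q ·x < a ·x → a ·x ≤ p ·x → base ·y < a ·y → ¬ a ·y < p ·y

  -- Strong induction on the height of `q`. If `p′` produced `q` from `q′`, the region cleared for
  -- that view covers the rows below `p′`, and it is wide enough because `p′` lies right of `p`; the
  -- view of `q` itself covers the rows from `q` up.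
  columnBase : ∀ {p q} → Sees S p q → ColumnBase p q
  columnBase {q = q} v = <-rec Goal step (q ·y) refl v
    where
    Goal : ℕ → Set
    Goal n = ∀ {p q} → q ·y ≡ n → Sees S p q → ColumnBase p q
    step : ∀ n → (∀ {k} → k < n → Goal k) → Goal n
    step n ih {p} {q} refl v with S-origin (source v)
    ... | inj₁ q∈P = record
      { base = q ; base∈P = q∈P ; sameˣ = refl ; lower = ≤-refl
      ; clear = λ a∈ q<a a≤p q<ya ya<p →
          <⇒≢ q<a (sym (cong _·x (alone v a∈ (<⇒≤ q<a) a≤p (<⇒≤ q<ya) ya<p))) }
    ... | inj₂ (p′ , q′ , p′∈P , v′ , refl) with ih (below v′) refl v′
    ... | B = record
      { base = base ; base∈P = base∈P ; sameˣ = sameˣ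
      ; lower = ≤-trans lower (<⇒≤ (below v′))
      ; clear = λ {a} a∈ q<a a≤p b<ya ya<p → case a ·y <? p′ ·y of λ where
          (yes ya<p′) → clear a∈ q<a (≤-trans a≤p (<⇒≤ (producer-right p′∈P v′ v))) b<ya ya<p′
          (no  ya≮p′) → <⇒≢ q<a (sym (cong _·x (alone v a∈ (<⇒≤ q<a) a≤p (≮⇒≥ ya≮p′) ya<p))) }
      where open ColumnBase B

  original-below : ∀ {a} → a ∈ S → ∃[ o ] (o ∈ P × o ·x ≡ a ·x × o ·y ≤ a ·y)
  original-below a∈ with S-origin a∈
  ... | inj₁ a∈P = _ , a∈P , refl , ≤-refl
  ... | inj₂ (p , q , p∈P , v , refl) = base , base∈P , sameˣ , ≤-trans lower (<⇒≤ (below v))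
    where open ColumnBase (columnBase v)

  -- The next point t to the right of p among those below p would see everything that p sees
  -- below the row of t, and would thereby hide it from p.
  neighbour-low : ∀ {p q t} → Sees S p q → t ∈ P → p ·x < t ·x → t ·y < p ·y →
    (∀ {b} → b ∈ P → p ·x < b ·x × b ·y < p ·y → t ·x ≤ b ·x) → t ·y ≤ q ·y
  neighbour-low {p} {q} {t} v t∈P p<t t<p nearest = ≮⇒≥ λ q<t →
    let t-sees-q = sees (source v) (<-trans (left v) p<t) q<t alone′
        corner   = alone v (S-closed t∈P t-sees-q) ≤-refl (<⇒≤ (left v)) (<⇒≤ q<t) t<p
    in <⇒≢ q<t (sym (cong _·y corner))
    where
    alone′ : ∀ {a} → a ∈ S → q ·x ≤ a ·x → a ·x ≤ t ·x → q ·y ≤ a ·y → a ·y < t ·y → a ≡ q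
    alone′ {a} a∈ q≤a a≤t q≤ya ya<t with a ·x ≤? p ·x
    ... | yes a≤p = alone v a∈ q≤a a≤p q≤ya (<-trans ya<t t<p)
    -- An original point under `a` lies right of `p` and below it, so by the choice of `t` it can
    -- only be `t`; but `a` is below the row of `t`.
    ... | no  a≰p with original-below a∈
    ... | o , o∈P , ox≡ , oy≤ =
      let p<o = subst (p ·x <_) (sym ox≡) (≰⇒> a≰p)
          t≤o = nearest o∈P (p<o , ≤-<-trans oy≤ (<-trans ya<t t<p))
          o≡t = x-injective o∈P t∈P (≤-antisym (subst (_≤ t ·x) (sym ox≡) a≤t) t≤o)
      in contradiction (subst (λ b → b ·y ≤ a ·y) o≡t oy≤) (<⇒≱ ya<t)

  -- Construction of z-rectangles

  -- The corners are extremal points: `s` is the leftmost point right of `p` with height strictly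
  -- between `o` and `p`, for which `e` is a candidate; `r` is the highest point below `o` in the
  -- columns strictly between `p` and `s`; `q` is the rightmost point left of `p` and not left of
  -- `o`, above `r` and at most as high as `o`. The hypothesis `low` supplies a candidate for `r`,
  -- and `o` is one for `q`.
  zRect-from : ∀ {p o e} → p ∈ P → o ∈ P → e ∈ P → o ·x < p ·x → p ·x < e ·x →
    o ·y < e ·y → e ·y < p ·y →
    (∀ {a} → a ∈ P → o ·x < a ·x → a ·x ≤ p ·x → o ·y < a ·y → ¬ a ·y < p ·y) →
    (∀ {t} → t ∈ P → p ·x < t ·x → t ·y < p ·y →
      (∀ {b} → b ∈ P → p ·x < b ·x × b ·y < p ·y → t ·x ≤ b ·x) → t ·y < o ·y) →
    HasTop P p
  zRect-from {p} {o} {e} p∈P o∈P e∈P o<p p<e o<ye e<yp clear low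
    with least {_≲_ = λ a b → a ·x ≤ b ·x} ≤-trans (λ a b → ≤-total (a ·x) (b ·x))
           (λ a → p ·x <? a ·x ×-dec a ·y <? p ·y) P e∈P (p<e , e<yp)
       | least {_≲_ = λ a b → a ·x ≤ b ·x} ≤-trans (λ a b → ≤-total (a ·x) (b ·x))
           (λ a → p ·x <? a ·x ×-dec o ·y <? a ·y ×-dec a ·y <? p ·y) P e∈P (p<e , o<ye , e<yp)
  ... | t , t∈P , (p<t , t<yp) , t≤ | s , s∈P , (p<s , o<ys , s<yp) , s≤
    with low t∈P p<t t<yp t≤
  ... | t<yo
    with least {_≲_ = λ a b → a ·y ≥ b ·y} (λ i≥j j≥k → ≤-trans j≥k i≥j)
           (λ a b → ≤-total (b ·y) (a ·y))
           (λ a → p ·x <? a ·x ×-dec a ·x <? s ·x ×-dec a ·y <? o ·y) P t∈P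
           -- `s` also competes for nearest, so `t` is not right of `s`; their columns differ
           -- because `o` separates their heights.
           (p<t , ≤∧≢⇒< (t≤ s∈P (p<s , s<yp))
                    (λ eq → <⇒≢ (<-trans t<yo o<ys) (cong _·y (x-injective t∈P s∈P eq)))
                , t<yo)
  ... | r , r∈P , (p<r , r<s , r<yo) , ≤r
    with least {_≲_ = λ a b → a ·x ≥ b ·x} (λ i≥j j≥k → ≤-trans j≥k i≥j)
           (λ a b → ≤-total (b ·x) (a ·x))
           (λ a → o ·x ≤? a ·x ×-dec a ·x <? p ·x ×-dec r ·y <? a ·y ×-dec a ·y ≤? o ·y) P o∈P
           (≤-refl , o<p , r<yo , ≤-refl)
  ... | q , q∈P , (o≤q , q<p , r<yq , q≤yo) , ≤q =
    q , r , s , q∈P , r∈P , s∈P ,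
    (q<p , p<r , r<s , r<yq , ≤-<-trans q≤yo o<ys , s<yp) , only
    where
    only : ∀ {a} → a ∈ P → InBox (q ·x) (s ·x) (r ·y) (p ·y) a → a ≡ p ⊎ a ≡ q ⊎ a ≡ r ⊎ a ≡ s
    only {a} a∈P (q≤a , a≤s , r≤ya , ya≤p) with m≤n⇒m<n∨m≡n ya≤p | m≤n⇒m<n∨m≡n r≤ya
    ... | inj₂ eq | _ = inj₁ (y-injective a∈P p∈P eq)
    ... | inj₁ _ | inj₂ eq = inj₂ (inj₂ (inj₁ (y-injective a∈P r∈P (sym eq))))
    -- The column of `p` and the row of `o` cut the box into quadrants: `clear` empties the upper
    -- left, and the extremal choices leave only `q` on the lower left, `s` on the upper right and
    -- nothing above `r` on the lower right.
    ... | inj₁ ya<p | inj₁ r<ya with <-cmp (a ·x) (p ·x) | <-cmp (a ·y) (o ·y)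
    ... | tri≈ _ eq _ | _ = inj₁ (x-injective a∈P p∈P eq)
    ... | tri< a<p _ _ | tri> _ _ o<ya = case m≤n⇒m<n∨m≡n (≤-trans o≤q q≤a) of λ where
        (inj₁ o<a) → contradiction ya<p (clear a∈P o<a (<⇒≤ a<p) o<ya)
        (inj₂ eq)  → contradiction (cong _·y (x-injective o∈P a∈P eq)) (<⇒≢ o<ya)
    ... | tri< a<p _ _ | tri≈ _ eq _ =
        inj₂ (inj₁ (x-injective a∈P q∈P
          (≤-antisym (≤q a∈P (≤-trans o≤q q≤a , a<p , r<ya , ≤-reflexive eq)) q≤a)))
    ... | tri< a<p _ _ | tri< ya<o _ _ =
        inj₂ (inj₁ (x-injective a∈P q∈P
          (≤-antisym (≤q a∈P (≤-trans o≤q q≤a , a<p , r<ya , <⇒≤ ya<o)) q≤a)))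
    ... | tri> _ _ p<a | tri> _ _ o<ya =
        inj₂ (inj₂ (inj₂ (x-injective a∈P s∈P (≤-antisym a≤s (s≤ a∈P (p<a , o<ya , ya<p))))))
    ... | tri> _ _ p<a | tri≈ _ eq _ =
        contradiction (cong _·x (y-injective o∈P a∈P (sym eq))) (<⇒≢ (<-trans o<p p<a))
    ... | tri> _ _ p<a | tri< ya<o _ _ = case m≤n⇒m<n∨m≡n a≤s of λ where
        (inj₁ a<s) → contradiction r<ya (≤⇒≯ (≤r a∈P (p<a , a<s , ya<o)))
        (inj₂ eq)  → contradiction (cong _·y (x-injective a∈P s∈P eq)) (<⇒≢ (<-trans ya<o o<ys))

  -- The producer `e` of `q` is right of `p` and, as `q` is not original, strictly above `base`. The
  -- second view pushes the nearest lower right neighbour of `p` under `base`: `clear` keeps `q′`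
  -- from lying above `base`, and `neighbour-low` bounds the neighbour by `q′`.
  two-views⇒zRect : ∀ {p q q′} → p ∈ P → Sees S p q → q ∉ P → Sees S p q′ → q ·x < q′ ·x → HasTop P p
  two-views⇒zRect {p} {q} {q′} p∈P v q∉P v′ q<q′ with S-origin (source v)
  ... | inj₁ q∈P = contradiction q∈P q∉P
  ... | inj₂ (e , _ , e∈P , w , refl) =
    zRect-from p∈P base∈P e∈P o<p (producer-right e∈P w v)
      (≤∧≢⇒< lower λ eq → q∉P (subst (_∈ P) (cong₂ _,_ sameˣ eq) base∈P))
      (below v)
      (λ a∈P o<a → clear (P⊆S a∈P) (subst (_< _) sameˣ o<a))
      λ t∈P p<t t<p nearest →
        ≤∧≢⇒< (≤-trans (neighbour-low v′ t∈P p<t t<p nearest) q′≤o)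
              λ eq → <⇒≢ (<-trans o<p p<t) (sym (cong _·x (y-injective t∈P base∈P eq)))
    where
    open ColumnBase (columnBase v)
    o<p : base ·x < p ·x
    o<p = subst (_< p ·x) (sym sameˣ) (left v)
    q′≤o : q′ ·y ≤ base ·y
    q′≤o = ≮⇒≥ λ o<q′ → clear (source v′) q<q′ (<⇒≤ (left v′)) o<q′ (below v′)

  -- Charging the added points

  seen-once : ∀ {p p′ q} → p ∈ P → p′ ∈ P → Sees S p q → Sees S p′ q → p ·y ≡ p′ ·y
  seen-once {p} {p′} p∈P p′∈P v v′ with <-cmp (p ·y) (p′ ·y)
  ... | tri≈ _ eq _ = eq
  ... | tri< p<p′ _ _ = contradiction
    (sym (cong _·y (alone v′ (S-closed p∈P v) ≤-refl (<⇒≤ (left v′)) (<⇒≤ (below v)) p<p′)))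
    (<⇒≢ (below v))
  ... | tri> _ _ p′<p = contradiction
    (sym (cong _·y (alone v (S-closed p′∈P v′) ≤-refl (<⇒≤ (left v)) (<⇒≤ (below v′)) p′<p)))
    (<⇒≢ (below v′))

  data Label : Set where
    column row : Label
    top        : Point → Label

  -- In a row that may top a z-rectangle the target spells out both coordinates of the corner, at
  -- the price of a separate label for each such row. The other two labels are shared by all columns
  -- and by all rows.
  data Charged (a : Point) : Label × Point → Set where
    toColumn : ∀ {p q} → p ∈ P → Sees S p q → a ≡ (q ·x , p ·y) → Charged a (column , q)
    toRow    : ∀ {p q} → p ∈ P → q ∉ P → Sees S p q → ¬ HasTop P p → a ≡ (q ·x , p ·y) →
               Charged a (row , p)
    toTop    : ∀ {p o} → a ≡ (o ·x , p ·y) → Charged a (top p , o)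

  -- Two charges to one row from different columns would be two views whose left point is not
  -- original, hence a z-rectangle with top `p`.
  Charged-injective : ∀ {a a′ t} → Charged a t → Charged a′ t → a ≡ a′
  Charged-injective (toColumn p∈ v refl) (toColumn p′∈ v′ refl) =
    cong (_ ,_) (seen-once p∈ p′∈ v v′)
  Charged-injective (toTop refl) (toTop refl) = refl
  Charged-injective (toRow {q = q} p∈ q∉ v ¬top refl) (toRow {q = q′} _ q′∉ v′ _ refl)
    with <-cmp (q ·x) (q′ ·x)
  ... | tri< q<q′ _ _ = contradiction (two-views⇒zRect p∈ v q∉ v′ q<q′) ¬top
  ... | tri≈ _ eq _   = cong (_, _) eq
  ... | tri> _ _ q′<q = contradiction (two-views⇒zRect p∈ v′ q′∉ v q′<q) ¬top

  added-≤ : ∀ {A} (tops : List Point) → (∀ {p} → p ∈ P → HasTop P p → p ∈ tops) →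
    Unique A → (∀ {a} → a ∈ A → a ∈ S × a ∉ P) → length A ≤ (2 + length tops) * length P
  added-≤ {A} tops complete A! A⊆ = begin
    length A                                  ≤⟨ length-≤-by-injection Charged-injective _ A! charge ⟩
    length (cartesianProduct labels P)        ≡⟨ length-cartesianProduct labels P ⟩
    (2 + length (map top tops)) * length P    ≡⟨ cong (λ n → (2 + n) * length P) (length-map top tops) ⟩
    (2 + length tops) * length P              ∎
    where
    open ≤-Reasoning
    labels : List Label
    labels = column ∷ row ∷ map top tops
    charge : ∀ {a} → a ∈ A → ∃[ t ] (t ∈ cartesianProduct labels P × Charged a t)
    charge a∈A with A⊆ a∈A
    ... | a∈S , a∉P with S-origin a∈S
    ... | inj₁ a∈P = contradiction a∈P a∉P
    ... | inj₂ (p , q , p∈P , v , refl) with q ∈? P | p ∈? tops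
    ... | yes q∈P | _ = _ , ∈-cartesianProduct⁺ {xs = labels} (here refl) q∈P , toColumn p∈P v refl
    ... | no q∉P | no p∉tops = _ , ∈-cartesianProduct⁺ {xs = labels} (there (here refl)) p∈P ,
        toRow p∈P q∉P v (p∉tops ∘ complete p∈P) refl
    -- The target must be an original point, so `q` is replaced by the base of its column.
    ... | no q∉P | yes p∈tops =
        _ , ∈-cartesianProduct⁺ {xs = labels} (there (there (∈-map⁺ top p∈tops))) base∈P ,
        toTop {p = p} (cong (_, p ·y) (sym sameˣ))
      where open ColumnBase (columnBase v)

-- The sweep

⊆-sweep : ∀ Q ps {a} → a ∈ Q → a ∈ sweep Q ps
⊆-sweep Q []       a∈ = a∈
⊆-sweep Q (p ∷ ps) a∈ = ⊆-sweep (Q ++ newPoints Q p) ps (∈-++⁺ˡ a∈)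

newPoint-test : List Point → Point → Point → Bool
newPoint-test Q p q = (q ·x <ᵇ p ·x) ∧ (q ·y <ᵇ p ·y) ∧ emptyRect Q p q

∈-newPoints⁺ : ∀ Q p {q} → q ∈ Q → T (newPoint-test Q p q) → (q ·x , p ·y) ∈ newPoints Q p
∈-newPoints⁺ Q p q∈ t = ∈-map⁺ _ (∈-filter⁺ (T? ∘ newPoint-test Q p) q∈ t)

∈-newPoints⁻ : ∀ Q p {a} → a ∈ newPoints Q p →
  ∃[ q ] (q ∈ Q × T (newPoint-test Q p q) × a ≡ (q ·x , p ·y))
∈-newPoints⁻ Q p a∈ with ∈-map⁻ _ a∈
... | q , q∈ , eq with ∈-filter⁻ (T? ∘ newPoint-test Q p) {xs = Q} q∈
... | q∈Q , t = q , q∈Q , t , eq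

sweep-rows : ∀ Q ps {a} → a ∈ sweep Q ps → a ∈ Q ⊎ ∃[ p ] (p ∈ ps × a ·y ≡ p ·y)
sweep-rows Q []       a∈ = inj₁ a∈
sweep-rows Q (p ∷ ps) a∈ with sweep-rows (Q ++ newPoints Q p) ps a∈
... | inj₂ (p′ , p′∈ , eq) = inj₂ (p′ , there p′∈ , eq)
... | inj₁ a∈Q′ with ∈-++⁻ Q a∈Q′
... | inj₁ a∈Q = inj₁ a∈Q
... | inj₂ new with ∈-newPoints⁻ Q p new
... | _ , _ , _ , refl = inj₂ (p , here refl , refl)

module Sweep (P : List Point)
  (y-injective : ∀ {a b} → a ∈ P → b ∈ P → a ·y ≡ b ·y → a ≡ b) where

  Increasing : List Point → Set
  Increasing = AllPairs (λ a b → a ·y < b ·y)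

  -- Invariant of the sweep, kept because each addition lies in the row just treated. It makes `p`
  -- the only point of its row when `p` is reached.
  Untouched : List Point → List Point → Set
  Untouched Q ps = ∀ {p a} → p ∈ ps → a ∈ Q → p ·y ≤ a ·y → a ∈ P

  Untouched-step : ∀ {Q p ps} → Increasing (p ∷ ps) → Untouched Q (p ∷ ps) →
    Untouched (Q ++ newPoints Q p) ps
  Untouched-step {Q} {p} (p< ∷ _) untouched p′∈ a∈ p′≤a with ∈-++⁻ Q a∈
  ... | inj₁ a∈Q = untouched (there p′∈) a∈Q p′≤a
  ... | inj₂ new with ∈-newPoints⁻ Q p new
  ... | _ , _ , _ , refl = contradiction p′≤a (<⇒≱ (lookup p< p′∈))

  -- Later additions fall in the row of `p` or higher, so the set below `p` is final once `p` is
  -- reached. Hence tests against the current `Q` can be compared with views in the final set.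
  below-head : ∀ {Q p ps a} → Increasing (p ∷ ps) → a ∈ sweep Q (p ∷ ps) → a ·y < p ·y → a ∈ Q
  below-head {Q} {p} {ps} (p< ∷ _) a∈ a<p with sweep-rows Q (p ∷ ps) a∈
  ... | inj₁ a∈Q = a∈Q
  ... | inj₂ (_ , here refl , eq) = contradiction eq (<⇒≢ a<p)
  ... | inj₂ (_ , there p′∈ , eq) = contradiction eq (<⇒≢ (<-trans a<p (lookup p< p′∈)))

  module _ {Q : List Point} {p : Point} {ps : List Point} (inc : Increasing (p ∷ ps)) where

    test⇒Sees : ∀ {q} → q ∈ Q → T (newPoint-test Q p q) → Sees (sweep Q (p ∷ ps)) p q
    test⇒Sees {q} q∈Q t =
      let tx , t′ = to T-∧ t ; ty , empty = to T-∧ t′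
          q<p = <ᵇ⇒< (q ·x) (p ·x) tx ; q<yp = <ᵇ⇒< (q ·y) (p ·y) ty
      in sees (⊆-sweep Q (p ∷ ps) q∈Q) q<p q<yp λ {a} a∈ q≤a a≤p q≤ya ya<p →
        let inside = subst (λ b → T (b a)) (sym (inRect-lowerLeft (<⇒≤ q<p) (<⇒≤ q<yp)))
                       (inBox⁺ a (q≤a , a≤p , q≤ya , <⇒≤ ya<p))
        in case to T-∨ (T-⇒⁻ (lookup (all⁺ _ Q empty) (below-head inc a∈ ya<p)) inside) of λ where
          (inj₁ a≡p) → contradiction (cong _·y (≡ₚ⁻ a p a≡p)) (<⇒≢ ya<p)
          (inj₂ a≡q) → ≡ₚ⁻ a q a≡q

    Sees⇒test : ∀ {q} → p ∈ P → Untouched Q (p ∷ ps) → Sees (sweep Q (p ∷ ps)) p q →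
      T (newPoint-test Q p q)
    Sees⇒test {q} p∈P untouched v =
      from T-∧ (<⇒<ᵇ left , from T-∧ (<⇒<ᵇ below , all⁻ _ (tabulate λ a∈ → T-⇒⁺ (test a∈))))
      where
      open Sees v
      test : ∀ {a} → a ∈ Q → T (inRect p q a) → T ((a ≡ₚ p) ∨ (a ≡ₚ q))
      test {a} a∈ t
        with inBox⁻ a (subst (λ b → T (b a)) (inRect-lowerLeft {p} {q} (<⇒≤ left) (<⇒≤ below)) t)
      ... | q≤a , a≤p , q≤ya , ya≤p with m≤n⇒m<n∨m≡n ya≤p
      ... | inj₁ ya<p = from T-∨ (inj₂ (≡ₚ⁺ (alone (⊆-sweep Q (p ∷ ps) a∈) q≤a a≤p q≤ya ya<p)))
      -- `emptyRect` includes the row of `p`, which `Sees` omits; by the invariant a point of `Q` in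
      -- that row is `p` itself.
      ... | inj₂ eq   = from T-∨ (inj₁ (≡ₚ⁺
            (y-injective (untouched (here refl) a∈ (≤-reflexive (sym eq))) p∈P eq)))

  -- Supplies `S-origin`, as `sweep-closed` supplies `S-closed`. Since `sweep` on `p ∷ ps` unfolds
  -- to `sweep` on the extended `Q`, the final set is the same at every stage and views pass through
  -- the recursion unchanged.
  sweep-origin : ∀ Q ps → Increasing ps → ∀ {a} → a ∈ sweep Q ps →
    a ∈ Q ⊎ ∃[ p ] ∃[ q ] (p ∈ ps × Sees (sweep Q ps) p q × a ≡ (q ·x , p ·y))
  sweep-origin Q []       _             a∈ = inj₁ a∈
  sweep-origin Q (p ∷ ps) inc@(_ ∷ inc′) a∈ with sweep-origin (Q ++ newPoints Q p) ps inc′ a∈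
  ... | inj₂ (p′ , q , p′∈ , v , eq) = inj₂ (p′ , q , there p′∈ , v , eq)
  ... | inj₁ a∈Q′ with ∈-++⁻ Q a∈Q′
  ... | inj₁ a∈Q = inj₁ a∈Q
  ... | inj₂ new with ∈-newPoints⁻ Q p new
  ... | q , q∈Q , t , eq = inj₂ (p , q , here refl , test⇒Sees inc q∈Q t , eq)

  sweep-closed : ∀ Q ps → Increasing ps → (∀ {p} → p ∈ ps → p ∈ P) → Untouched Q ps →
    ∀ {p q} → p ∈ ps → Sees (sweep Q ps) p q → (q ·x , p ·y) ∈ sweep Q ps
  sweep-closed Q (p ∷ ps) inc ps⊆P untouched (here refl) v =
    ⊆-sweep (Q ++ newPoints Q p) ps (∈-++⁺ʳ Q (∈-newPoints⁺ Q p
      (below-head inc (Sees.source v) (Sees.below v))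
      (Sees⇒test inc (ps⊆P (here refl)) untouched v)))
  sweep-closed Q (p ∷ ps) inc@(_ ∷ inc′) ps⊆P untouched (there p′∈) v =
    sweep-closed (Q ++ newPoints Q p) ps inc′ (ps⊆P ∘ there) (Untouched-step inc untouched) p′∈ v

-- z-rectangle count

∈-tuples4 : ∀ {P p q r s} → p ∈ P → q ∈ P → r ∈ P → s ∈ P → (p , q , r , s) ∈ tuples4 P
∈-tuples4 p∈ q∈ r∈ s∈ =
  ∈-concatMap⁺ _ (lose p∈ (∈-concatMap⁺ _ (lose q∈ (∈-concatMap⁺ _ (lose r∈ (∈-map⁺ _ s∈))))))

isZRect⁺ : ∀ {P p q r s} → ZRect P p q r s → T (isZRect P p q r s)
isZRect⁺ {P} {p} {q} {r} {s} ((a , b , c , d , e , f) , only) =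
  from T-∧ (<⇒<ᵇ a , from T-∧ (<⇒<ᵇ b , from T-∧ (<⇒<ᵇ c , from T-∧ (<⇒<ᵇ d ,
  from T-∧ (<⇒<ᵇ e , from T-∧ (<⇒<ᵇ f , all⁻ _ (tabulate λ {u} u∈ → T-⇒⁺ λ t →
    corner (only u∈ (inBox⁻ u t)))))))))
  where
  corner : ∀ {u} → u ≡ p ⊎ u ≡ q ⊎ u ≡ r ⊎ u ≡ s →
    T ((u ≡ₚ p) ∨ (u ≡ₚ q) ∨ (u ≡ₚ r) ∨ (u ≡ₚ s))
  corner {u} (inj₁ eq)               = from (T-∨ {u ≡ₚ p}) (inj₁ (≡ₚ⁺ eq))
  corner {u} (inj₂ (inj₁ eq))        = from (T-∨ {u ≡ₚ p}) (inj₂ (from (T-∨ {u ≡ₚ q}) (inj₁ (≡ₚ⁺ eq))))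
  corner {u} (inj₂ (inj₂ (inj₁ eq))) =
    from (T-∨ {u ≡ₚ p}) (inj₂ (from (T-∨ {u ≡ₚ q}) (inj₂ (from (T-∨ {u ≡ₚ r}) (inj₁ (≡ₚ⁺ eq))))))
  corner {u} (inj₂ (inj₂ (inj₂ eq))) =
    from (T-∨ {u ≡ₚ p}) (inj₂ (from (T-∨ {u ≡ₚ q}) (inj₂ (from (T-∨ {u ≡ₚ r}) (inj₂ (≡ₚ⁺ eq))))))

-- Repetitions among the tops are kept, so that the length is the z-rectangle count itself.
zRectTops : ∀ P → ∃[ tops ] (length tops ≡ zRectCount P × (∀ {p} → p ∈ P → HasTop P p → p ∈ tops))
zRectTops P =
  map proj₁ (filterᵇ _ (tuples4 P)) , length-map proj₁ (filterᵇ _ (tuples4 P)) ,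
  λ { p∈ (q , r , s , q∈ , r∈ , s∈ , z) →
      ∈-map⁺ proj₁ (∈-filter⁺ (T? ∘ _) (∈-tuples4 p∈ q∈ r∈ s∈) (isZRect⁺ z)) }

-- Access sequences

length-G : ∀ X → length (G X) ≡ length X
length-G X = trans (length-zipWith _,_ X _)
  (trans (cong (length X ⊓_) (length-applyUpTo suc (length X))) (⊓-idem (length X)))

T-not⁻ : ∀ {b} → T (not b) → ¬ T b
T-not⁻ {false} _ ()

∈ₚ⁺ : ∀ {a Q} → a ∈ Q → T (a ∈ₚ Q)
∈ₚ⁺ {a} (here refl)        = from T-∨ (inj₁ (≡ₚ⁺ {a} refl))
∈ₚ⁺ {a} (there {x = b} a∈) = from (T-∨ {a ≡ₚ b}) (inj₂ (∈ₚ⁺ a∈))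

add↑-⊆ : ∀ P {a} → a ∈ add↑ P → a ∈ sweep P P × a ∉ P
add↑-⊆ P a∈ with ∈-filter⁻ (T? ∘ (λ b → not (b ∈ₚ P))) {xs = sweep P P} (∈-deduplicate⁻ _ _ a∈)
... | a∈S , t = a∈S , T-not⁻ t ∘ ∈ₚ⁺

IRB↑-≤ : ∀ X → Unique X → IRB↑ X ≤ (2 + zRectCount (G X)) * length X
IRB↑-≤ X X! with zRectTops (G X)
... | tops , len , complete =
  subst (λ n → IRB↑ X ≤ n) (cong₂ (λ k n → (2 + k) * n) len (length-G X))
    (Closure.added-≤ P (sweep P P) x-inj y-inj (⊆-sweep P P)
      (sweep-origin P P increasing)
      -- The sweep starts with `Q` equal to `P`, where the invariant is immediate.
      (sweep-closed P P increasing id (λ _ a∈ _ → a∈))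
      tops complete (deduplicate-! _) (add↑-⊆ P))
  where
  P : List Point
  P = G X
  pairs : AllPairs (λ a b → a ·x ≢ b ·x × a ·y < b ·y) P
  pairs = AllPairs-zip⁺ X! (applyUpTo⁺₁ suc (length X) (λ i<j _ → s≤s i<j))
  increasing : AllPairs (λ a b → a ·y < b ·y) P
  increasing = AllPairs.map proj₂ pairs
  x-inj : ∀ {a b} → a ∈ P → b ∈ P → a ·x ≡ b ·x → a ≡ b
  x-inj = AllPairs-≢⇒injective (AllPairs.map proj₁ pairs)
  y-inj : ∀ {a b} → a ∈ P → b ∈ P → a ·y ≡ b ·y → a ≡ b
  y-inj = AllPairs-≢⇒injective (AllPairs.map <⇒≢ increasing)
  open Sweep P y-inj

theorem3 : (c : ℕ) → ∃[ C ] ((X : List ℕ) → Unique X → zRectCount (G X) ≤ c → IRB↑ X ≤ C * length X)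
-- One share of the length of `X` for the columns, one for the rows, and one for each of the at most
-- `c` z-rectangle tops.
theorem3 c = 2 + c , λ X X! z≤c →
  ≤-trans (IRB↑-≤ X X!) (*-monoˡ-≤ (length X) (+-monoʳ-≤ 2 z≤c))
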